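{- Let $\mathbf P=(P,\leq,*,1)$ be a strongly sectionally pseudocomplemented poset and $\Theta\in\operatorname{Con}\mathbf P$. Then every class of $\Theta$ is a convex subset of $(P,\leq)$.
   Context: For a poset $(P,\leq)$ and $A\subseteq P$, $U(A)$ and $L(A)$ denote the sets of all upper, respectively lower, bounds of $A$; $U(a,b)=U(\{a,b\})$, $L(b)=L(\{b\})$, $L(U(a,b),c)=L(U(a,b)\cup\{c\})$. The poset is sectionally pseudocomplemented if for all $a,b\in P$ there exists a greatest element $c$ of $P$ with $L(U(a,b),c)=L(b)$; this $c$ is denoted by $a*b$, and one writes $(P,\leq,*)$. A strongly sectionally pseudocomplemented poset is a quadruple $(P,\leq,*,1)$ such that $(P,\leq,*)$ is a sectionally pseudocomplemented poset with greatest element $1$ satisfying $x\leq(x*y)*y$ for all $x,y\in P$. A binary relation $\rho$ on $P$ is $\min$-stable if whenever $(a,b),(c,d)\in\rho$, $a$ is comparable with $c$ and $b$ is comparable with $d$, then $(\min(a,c),\min(b,d))\in\rho$. A congruence on $\mathbf P$ is a $\min$-stable congruence on the algebra $(P,*,1)$; $\operatorname{Con}\mathbf P$ is the set of all of them. A subset $A\subseteq P$ is convex if $x,y\in A$ and $x\leq z\leq y$ imply $z\in A$. -}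

module Defs where

open import Algebra.Definitions using (Congruent₂)
open import Level using (Level; suc; _⊔_)
open import Data.Product using (_×_; Σ-syntax; proj₁)
open import Data.Sum using (_⊎_; inj₁; inj₂)
open import Relation.Binary.Bundles using (Poset)
open import Relation.Binary.Core using (Rel; _⇒_)
open import Relation.Binary.Definitions using (Maximum)
open import Relation.Binary.Structures using (IsEquivalence)
open import Relation.Unary using (Pred; _∈_; _∪_; _≐_)

private
  variable
    c ℓ₁ ℓ₂ ℓ : Level

module PosetNotions (P : Poset c ℓ₁ ℓ₂) where
  open Poset P

  -- Singletons and pairs are taken up to the equality _≈_ of the poset.
  ⟦_⟧ : Carrier → Pred Carrier ℓ₁
  ⟦ a ⟧ x = x ≈ a

  ⟦_,_⟧ : Carrier → Carrier → Pred Carrier ℓ₁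
  ⟦ a , b ⟧ = ⟦ a ⟧ ∪ ⟦ b ⟧

  U : Pred Carrier ℓ → Pred Carrier (c ⊔ ℓ₂ ⊔ ℓ)
  U A x = ∀ y → y ∈ A → y ≤ x

  L : Pred Carrier ℓ → Pred Carrier (c ⊔ ℓ₂ ⊔ ℓ)
  L A x = ∀ y → y ∈ A → x ≤ y

  IsGreatest : Pred Carrier ℓ → Carrier → Set (c ⊔ ℓ₂ ⊔ ℓ)
  IsGreatest A m = m ∈ A × m ∈ U A

  -- m = a * b.  Antisymmetry determines such an m up to _≈_.
  IsSectionalPseudocomplement : Carrier → Carrier → Carrier →
                                Set (c ⊔ ℓ₁ ⊔ ℓ₂)
  IsSectionalPseudocomplement a b =
    IsGreatest (λ x → L (U ⟦ a , b ⟧ ∪ ⟦ x ⟧) ≐ L ⟦ b ⟧)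

  Convex : Pred Carrier ℓ → Set (c ⊔ ℓ₂ ⊔ ℓ)
  Convex A = ∀ x y z → x ∈ A → y ∈ A → x ≤ z → z ≤ y → z ∈ A

  Comparable : Rel Carrier ℓ₂
  Comparable a b = a ≤ b ⊎ b ≤ a

  min : ∀ a b → Comparable a b → Carrier
  min a b (inj₁ a≤b) = a
  min a b (inj₂ b≤a) = b

  MinStable : Rel Carrier ℓ → Set (c ⊔ ℓ₂ ⊔ ℓ)
  MinStable ρ = ∀ a b a′ b′ → ρ a b → ρ a′ b′ →
    (p : Comparable a a′) (q : Comparable b b′) →
    ρ (min a a′ p) (min b b′ q)

record StronglySectionallyPseudocomplementedPoset c ℓ₁ ℓ₂ :
         Set (suc (c ⊔ ℓ₁ ⊔ ℓ₂)) where
  infixl 7 _*_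
  field
    poset : Poset c ℓ₁ ℓ₂

  open Poset poset public
  open PosetNotions poset public

  field
    _*_        : Carrier → Carrier → Carrier
    1#         : Carrier
    *-isSectionalPseudocomplement :
                 ∀ a b → IsSectionalPseudocomplement a b (a * b)
    1#-maximum : Maximum _≤_ 1#
    x≤[x*y]*y  : ∀ x y → x ≤ (x * y) * y

module _ (𝐏 : StronglySectionallyPseudocomplementedPoset c ℓ₁ ℓ₂) where
  open StronglySectionallyPseudocomplementedPoset 𝐏

  record IsCongruence (Θ : Rel Carrier ℓ) : Set (c ⊔ ℓ₁ ⊔ ℓ₂ ⊔ ℓ) where
    field
      isEquivalence : IsEquivalence Θ
      -- Θ is a relation on P taken modulo _≈_; with isEquivalence, this
      -- says that Θ respects _≈_ in both arguments.
      ≈⇒Θ           : _≈_ ⇒ Θ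
      -- The constant 1# imposes no condition beyond reflexivity.
      *-cong        : Congruent₂ Θ _*_
      minStable     : MinStable Θ

  Con : ∀ ℓ → Set (c ⊔ ℓ₁ ⊔ ℓ₂ ⊔ suc ℓ)
  Con ℓ = Σ[ Θ ∈ Rel Carrier ℓ ] IsCongruence Θ

  Class : Con ℓ → Carrier → Pred Carrier ℓ
  Class Θ a x = proj₁ Θ a x

{-# OPTIONS --safe #-}
module Submission where

open import Level using (Level)
open import Data.Product using (_,_)
open import Data.Sum using (inj₁; inj₂)
open import Relation.Binary.Structures using (IsEquivalence)
open import Defs

-- Min-stability lets a related pair be truncated from above by a reflexive pair. Two members
-- `x ≤ y` of one class are related to each other; cutting both down by an intermediate `z` fixes
-- `x`, which lies below `z`, and turns `y` into `z`. Hence `z` is related to `x`, and so belongs to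
-- the same class.

theorem4p1 : ∀ {c ℓ₁ ℓ₂ ℓ : Level}
    (𝐏 : StronglySectionallyPseudocomplementedPoset c ℓ₁ ℓ₂) →
    let open StronglySectionallyPseudocomplementedPoset 𝐏 in
    (Θ : Con 𝐏 ℓ) (a : Carrier) → Convex (Class 𝐏 Θ a)
theorem4p1 𝐏 (Θ , isCongruence) a x y z aΘx aΘy x≤z z≤y = trans aΘx xΘz
  where
  open IsCongruence isCongruence
  open IsEquivalence isEquivalence

  -- (x , z) is the componentwise minimum of (x , y) and (z , z).
  xΘz : Θ x z
  xΘz = minStable x y z z (trans (sym aΘx) aΘy) refl (inj₁ x≤z) (inj₂ z≤y)
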